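{- Any two equivalent reduced operation sequences have the same profile.
   Context: Operation sequences: $\sigma[a]$ ($a\ge1$) denotes pushing the top $a$ elements of the input stack, as a block with relative order unchanged, onto the top of a working stack; $\tau[b]$ ($b\ge1$) denotes moving the top $b$ elements of the working stack, as a block with relative order unchanged, onto the top of an output stack; $\sigma=\sigma[1]$, $\tau=\tau[1]$. A well-formed operation sequence is a word $\alpha=\alpha_1\cdots\alpha_m$ in these symbols such that in every prefix the total push size is at least the total pop size, with equality for the whole word; its size $n$ is the total push size. Acting on an input stack containing $1,\dots,n$ with $1$ on top, it produces the permutation read from the final output stack top to bottom. Two well-formed sequences are equivalent if they have the same size and produce the same permutation. $\alpha$ is reduced if every consecutive pair $\alpha_i\alpha_{i+1}$ with $\alpha_i$ a push and $\alpha_{i+1}$ a pop equals $\sigma[1]\tau[1]$. The profile of $\alpha$ is the polygonal path through $v_0=(0,0),v_1,\dots,v_m$ where $v_i=v_{i-1}+(a,a)$ if $\alpha_i=\sigma[a]$ and $v_i=v_{i-1}+(b,-b)$ if $\alpha_i=\tau[b]$. -}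

module Defs where

open import Data.Integer using (+_)
open import Data.List using (List; []; _∷_; _++_; take; drop; map; upTo; foldl)
open import Data.List.Relation.Unary.Linked using (Linked)
open import Data.List.Scans.Base using (scanl)
open import Data.Nat using (ℕ; suc; _+_; _≤_; NonZero)
open import Data.Product using (_×_; _,_; ∃-syntax)
open import Data.Rational as ℚ using (ℚ; 0ℚ; 1ℚ)
open import Data.Sum using (_⊎_)
open import Level using (0ℓ)
open import Relation.Binary.PropositionalEquality using (_≡_)
open import Relation.Unary using (Pred; ∅)

data Op : Set where
  σ[_] : (a : ℕ) .{{_ : NonZero a}} → Op
  τ[_] : (b : ℕ) .{{_ : NonZero b}} → Op

σ τ : Op
σ = σ[ 1 ]
τ = τ[ 1 ]

data IsPush : Op → Set where
  push : ∀ {a} .{{_ : NonZero a}} → IsPush σ[ a ]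

data IsPop : Op → Set where
  pop : ∀ {b} .{{_ : NonZero b}} → IsPop τ[ b ]

Word : Set
Word = List Op

pushSize : Word → ℕ
pushSize []           = 0
pushSize (σ[ a ] ∷ α) = a + pushSize α
pushSize (τ[ b ] ∷ α) = pushSize α

popSize : Word → ℕ
popSize []           = 0
popSize (σ[ a ] ∷ α) = popSize α
popSize (τ[ b ] ∷ α) = b + popSize α

record WellFormed (α : Word) : Set where
  field
    prefix-≤ : ∀ β γ → β ++ γ ≡ α → popSize β ≤ pushSize β
    total-≡  : popSize α ≡ pushSize α

size : Word → ℕ
size = pushSize

-- Stacks are lists with the top element first.
record Stacks : Set where
  constructor ⟨_,_,_⟩
  field
    input working output : List ℕ

-- An operation asking for more elements than are available moves all of them;
-- this never happens when a well-formed word acts on an input of its own size.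
step : Stacks → Op → Stacks
step ⟨ i , w , o ⟩ σ[ a ] = ⟨ drop a i , take a i ++ w , o ⟩
step ⟨ i , w , o ⟩ τ[ b ] = ⟨ i , drop b w , take b w ++ o ⟩

initial : ℕ → Stacks
initial n = ⟨ map suc (upTo n) , [] , [] ⟩

-- The permutation in one-line notation.
produced : Word → List ℕ
produced α = Stacks.output (foldl step (initial (size α)) α)

Equivalent : Word → Word → Set
Equivalent α β = size α ≡ size β × produced α ≡ produced β

Reduced : Word → Set
Reduced = Linked (λ x y → IsPush x → IsPop y → x ≡ σ × y ≡ τ)

Point : Set
Point = ℚ × ℚ

move : Point → Op → Point
move (x , y) σ[ a ] = (x ℚ.+ (+ a ℚ./ 1) , y ℚ.+ (+ a ℚ./ 1))
move (x , y) τ[ b ] = (x ℚ.+ (+ b ℚ./ 1) , y ℚ.- (+ b ℚ./ 1))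

Segment : Point → Point → Pred Point 0ℓ
Segment (x₀ , y₀) (x₁ , y₁) (x , y) =
  ∃[ t ] 0ℚ ℚ.≤ t × t ℚ.≤ 1ℚ
       × x ≡ x₀ ℚ.+ t ℚ.* (x₁ ℚ.- x₀)
       × y ≡ y₀ ℚ.+ t ℚ.* (y₁ ℚ.- y₀)

PolygonalPath : List Point → Pred Point 0ℓ
PolygonalPath []           = ∅
PolygonalPath (v ∷ [])     = λ p → p ≡ v
PolygonalPath (v ∷ w ∷ vs) = λ p → Segment v w p ⊎ PolygonalPath (w ∷ vs) p

vertices : Word → List Point
vertices = scanl move (0ℚ , 0ℚ)

-- The profile is the path itself, not its list of vertices: σ[ 2 ] and σ σ
-- trace the same path. Every step increases the first coordinate, so the path
-- is determined by its set of points; and since all vertices are rational, it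
-- is determined by its set of rational points.
profile : Word → Pred Point 0ℓ
profile α = PolygonalPath (vertices α)

{-# OPTIONS --safe #-}

-- In a reduced sequence the first element popped after a run of pushes is the
-- one pushed last, hence larger than everything that entered the working stack
-- before it. So, in order of arrival on the output stack, the running maximum
-- of the output is always the number of elements pushed so far: position and
-- value of the left-to-right maxima are the numbers of pops and of pushes at
-- the peaks, and the produced permutation determines the profile.

module Submission where

open import Defs
open import Relation.Unary using (_≐_)

open import Data.Integer as ℤ using (+_)
import Data.Integer.Properties as ℤ
open import Data.List using (List; []; _∷_; _++_; take; drop; map; upTo; applyUpTo; iterate; foldl; length; replicate; reverse)
open import Data.List.Properties using (++-assoc; ++-identityʳ; length-++; length-iterate; length-reverse; length-take; length-drop; map-upTo; reverse-++)
open import Data.List.Relation.Unary.All as All using (All; []; _∷_)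
import Data.List.Relation.Unary.All.Properties as All
open import Data.List.Relation.Unary.Any.Properties using (reverse⁻)
open import Data.List.Relation.Unary.Linked as Linked using (_∷_)
open import Data.List.Scans.Base using (scanl)
open import Data.Nat using (ℕ; zero; suc; _+_; _∸_; _⊔_; _≤_; NonZero)
open import Data.Nat.Coprimality as Coprimality using (1-coprimeTo)
import Data.Nat.Properties as ℕ
open import Data.Product using (_×_; _,_; ∃-syntax)
open import Data.Rational as ℚ using (ℚ; 0ℚ; 1ℚ)
import Data.Rational.Properties as ℚ
open import Data.Rational.Solver using (module +-*-Solver)
open import Data.Sum using (inj₁; inj₂)
open import Function using (_∘_; it)
open import Relation.Binary.PropositionalEquality using (_≡_; refl; sym; trans; cong; cong₂; subst; module ≡-Reasoning)
open import Relation.Unary using (_∪_)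
open import Relation.Unary.Algebra using (∪-cong; ∪-assoc)
open import Relation.Unary.Properties using (≐-refl; ≐-sym; ≐-trans)

-- Words of unit operations

-- A normal form for the profile: cutting blocks into unit operations may change the permutation,
-- but not the path.
unitise : Word → Word
unitise []           = []
unitise (σ[ a ] ∷ α) = replicate a σ ++ unitise α
unitise (τ[ b ] ∷ α) = replicate b τ ++ unitise α

replicate-+-++ : ∀ {A : Set} m n {x : A} xs →
                 replicate (m + n) x ++ xs ≡ replicate m x ++ replicate n x ++ xs
replicate-+-++ zero    n xs = refl
replicate-+-++ (suc m) n xs = cong (_ ∷_) (replicate-+-++ m n xs)

-- Here `m` is the running maximum. Each entry costs one pop, and truncated subtraction inserts
-- pushes before it only when it is a new left-to-right maximum.
recordPath : ℕ → List ℕ → Word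
recordPath m []       = []
recordPath m (x ∷ xs) = replicate (x ∸ m) σ ++ τ ∷ recordPath (m ⊔ x) xs

-- Entries up to `m` are not records: they call for no push and leave the running maximum unchanged.
recordPath-below : ∀ {m xs} ys → All (_≤ m) xs →
                   recordPath m (xs ++ ys) ≡ replicate (length xs) τ ++ recordPath m ys
recordPath-below ys [] = refl
recordPath-below ys (x≤m ∷ xs≤m)
  rewrite ℕ.m≤n⇒m∸n≡0 x≤m | ℕ.m≥n⇒m⊔n≡m x≤m = cong (τ ∷_) (recordPath-below ys xs≤m)

-- The last push is kept apart from the other `d` so that the right-hand side shows the unit peak of
-- a reduced word.
recordPath-above : ∀ m d xs →
                   recordPath m (suc (m + d) ∷ xs) ≡ replicate d σ ++ σ ∷ τ ∷ recordPath (suc (m + d)) xs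
recordPath-above m d xs
  rewrite sym (ℕ.+-suc m d) | ℕ.m+n∸m≡n m (suc d) | ℕ.m≤n⇒m⊔n≡n (ℕ.m≤m+n m (suc d))
  = trans (cong (λ k → replicate k σ ++ rest) (ℕ.+-comm 1 d)) (replicate-+-++ d 1 rest)
  where rest = τ ∷ recordPath (m + suc d) xs

-- The output in order of arrival

-- A popped block is reversed because its deepest element counts as arriving first; the result is
-- the output stack read from bottom to top.
emitted : List ℕ → List ℕ → Word → List ℕ
emitted i w []           = []
emitted i w (σ[ a ] ∷ α) = emitted (drop a i) (take a i ++ w) α
emitted i w (τ[ b ] ∷ α) = reverse (take b w) ++ emitted i (drop b w) α

reverse-output : ∀ i w o α →
                 reverse (Stacks.output (foldl step ⟨ i , w , o ⟩ α)) ≡ reverse o ++ emitted i w α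
reverse-output i w o []           = sym (++-identityʳ (reverse o))
reverse-output i w o (σ[ a ] ∷ α) = reverse-output (drop a i) (take a i ++ w) o α
reverse-output i w o (τ[ b ] ∷ α) = begin
  reverse (Stacks.output (foldl step ⟨ i , drop b w , take b w ++ o ⟩ α))
    ≡⟨ reverse-output i (drop b w) (take b w ++ o) α ⟩
  reverse (take b w ++ o) ++ emitted i (drop b w) α
    ≡⟨ cong (_++ emitted i (drop b w) α) (reverse-++ (take b w) o) ⟩
  (reverse o ++ reverse (take b w)) ++ emitted i (drop b w) α
    ≡⟨ ++-assoc (reverse o) (reverse (take b w)) _ ⟩
  reverse o ++ reverse (take b w) ++ emitted i (drop b w) α ∎
  where open ≡-Reasoning

take-iterate : ∀ {A : Set} (f : A → A) x m n → take m (iterate f x (m + n)) ≡ iterate f x m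
take-iterate f x zero    n = refl
take-iterate f x (suc m) n = cong (x ∷_) (take-iterate f (f x) m n)

drop-iterate-suc : ∀ k m n → drop m (iterate suc k (m + n)) ≡ iterate suc (k + m) n
drop-iterate-suc k zero    n = cong (λ j → iterate suc j n) (sym (ℕ.+-identityʳ k))
drop-iterate-suc k (suc m) n =
  trans (drop-iterate-suc (suc k) m n) (cong (λ j → iterate suc j n) (sym (ℕ.+-suc k m)))

iterate-suc-≤ : ∀ k n → All (_≤ k + n) (iterate suc (suc k) n)
iterate-suc-≤ k zero    = []
iterate-suc-≤ k (suc n) rewrite ℕ.+-suc k n = ℕ.m≤m+n (suc k) n ∷ iterate-suc-≤ (suc k) n

-- The function `f` is left general because the recursion of `applyUpTo` composes it with `suc`.
applyUpTo-iterate-suc : ∀ (f : ℕ → ℕ) k n → (∀ i → f i ≡ k + i) → applyUpTo f n ≡ iterate suc k n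
applyUpTo-iterate-suc f k zero    f≗ = refl
applyUpTo-iterate-suc f k (suc n) f≗ =
  cong₂ _∷_ (trans (f≗ 0) (ℕ.+-identityʳ k))
            (applyUpTo-iterate-suc (f ∘ suc) (suc k) n (λ i → trans (f≗ (suc i)) (ℕ.+-suc k i)))

All-reverse : ∀ {A : Set} {P : A → Set} {xs} → All P xs → All P (reverse xs)
All-reverse pxs = All.tabulate (All.lookup pxs ∘ reverse⁻)

-- Acting with a working stack of height h leaves it empty and never underflows.
data Balanced : ℕ → Word → Set where
  []   : Balanced 0 []
  push : ∀ {h α} a .{{_ : NonZero a}} → Balanced (a + h) α → Balanced h (σ[ a ] ∷ α)
  pop  : ∀ {h α} b .{{_ : NonZero b}} → Balanced h α → Balanced (b + h) (τ[ b ] ∷ α)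

-- Induction on the word needs an arbitrary starting height; a prefix of the tail becomes a prefix
-- of the whole by restoring the first operation.
prefix-≤⇒Balanced : ∀ h α → (∀ β γ → β ++ γ ≡ α → popSize β ≤ h + pushSize β) →
                    popSize α ≡ h + pushSize α → Balanced h α
prefix-≤⇒Balanced h [] _ 0≡h+0 rewrite ℕ.m+n≡0⇒m≡0 h (sym 0≡h+0) = []
prefix-≤⇒Balanced h (σ[ a ] ∷ α) prefix total =
  push a (prefix-≤⇒Balanced (a + h) α
    (λ β γ eq → ℕ.≤-trans (prefix (σ[ a ] ∷ β) γ (cong (σ[ a ] ∷_) eq)) (ℕ.≤-reflexive (regroup β)))
    (trans total (regroup α)))
  where
  regroup : ∀ β → h + (a + pushSize β) ≡ a + h + pushSize β
  regroup β = trans (sym (ℕ.+-assoc h a _)) (cong (_+ pushSize β) (ℕ.+-comm h a))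
prefix-≤⇒Balanced h (τ[ b ] ∷ α) prefix total =
  subst (λ k → Balanced k (τ[ b ] ∷ α)) (ℕ.m+[n∸m]≡n b≤h) (pop b (prefix-≤⇒Balanced (h ∸ b) α
    (λ β γ eq → ℕ.+-cancelˡ-≤ b _ _
      (ℕ.≤-trans (prefix (τ[ b ] ∷ β) γ (cong (τ[ b ] ∷_) eq)) (ℕ.≤-reflexive (regroup β))))
    (ℕ.+-cancelˡ-≡ b _ _ (trans total (regroup α)))))
  where
  -- The one-letter prefix `τ[ b ]` already rules out underflow.
  b≤h : b ≤ h
  b≤h with b≤h+0 ← prefix (τ[ b ] ∷ []) α refl
    rewrite ℕ.+-identityʳ b | ℕ.+-identityʳ h = b≤h+0
  regroup : ∀ β → h + pushSize β ≡ b + (h ∸ b + pushSize β)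
  regroup β = trans (cong (_+ pushSize β) (sym (ℕ.m+[n∸m]≡n b≤h))) (ℕ.+-assoc b (h ∸ b) _)

wellFormed⇒Balanced : ∀ {α} → WellFormed α → Balanced 0 α
wellFormed⇒Balanced wf = prefix-≤⇒Balanced 0 _ prefix-≤ total-≡
  where open WellFormed wf

-- The argument m is the largest element emitted so far and d the number of
-- elements pushed since then; d may be positive only if a push comes next.
mutual
  unitise≡recordPath : ∀ m w α → All (_≤ m) w → Balanced (length w) α → Reduced α →
    unitise α ≡ recordPath m (emitted (iterate suc (suc m) (pushSize α)) w α)
  unitise≡recordPath m w [] w≤m bal red = refl
  unitise≡recordPath m w (σ[ a ] ∷ α) w≤m bal red
    -- A run of pushes begins here, with nothing yet pushed beyond `m`.
    with eq ← push-unitise≡recordPath m 0 w a α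
    rewrite ℕ.+-identityʳ m = eq w≤m bal red
  unitise≡recordPath m w (τ[ b ] ∷ α) w≤m bal red with length w in |w|≡
  unitise≡recordPath m w (τ[ b ] ∷ α) w≤m (pop {h} .b bal) red | .(b + h) = begin
    replicate b τ ++ unitise α
      ≡⟨ cong₂ (λ k β → replicate k τ ++ β) (sym |top|≡b)
           (unitise≡recordPath m (drop b w) α (All.drop⁺ b w≤m)
             (subst (λ k → Balanced k α) (sym |rest|≡h) bal) (Linked.tail red)) ⟩
    replicate (length (reverse (take b w))) τ ++ recordPath m later
      -- The whole working stack is bounded by `m`, so the popped block contains no record.
      ≡⟨ recordPath-below later (All-reverse (All.take⁺ b w≤m)) ⟨
    recordPath m (reverse (take b w) ++ later) ∎
    where
    open ≡-Reasoning
    later = emitted (iterate suc (suc m) (pushSize α)) (drop b w) α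
    |top|≡b : length (reverse (take b w)) ≡ b
    |top|≡b rewrite length-reverse (take b w) | length-take b w | |w|≡ = ℕ.m≤n⇒m⊓n≡m (ℕ.m≤m+n b h)
    |rest|≡h : length (drop b w) ≡ h
    |rest|≡h rewrite length-drop b w | |w|≡ = ℕ.m+n∸m≡n b h

  push-unitise≡recordPath : ∀ m d w a .{{_ : NonZero a}} α →
    All (_≤ m + d) w → Balanced (length w) (σ[ a ] ∷ α) → Reduced (σ[ a ] ∷ α) →
    replicate d σ ++ unitise (σ[ a ] ∷ α) ≡
      recordPath m (emitted (iterate suc (suc (m + d)) (a + pushSize α)) w (σ[ a ] ∷ α))
  -- A final push would leave the working stack nonempty; the pattern `suc _` makes its height
  -- visibly nonzero.
  push-unitise≡recordPath m d w (suc _) [] w≤ (push _ ()) red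
  -- The run continues: the `a` pushes join the `d` pending ones, and the new block is bounded by
  -- `m + d + a`.
  push-unitise≡recordPath m d w a (σ[ b ] ∷ α) w≤ (push .a bal) red
    rewrite take-iterate suc (suc (m + d)) a (b + pushSize α)
          | drop-iterate-suc (suc (m + d)) a (b + pushSize α)
          | ℕ.+-assoc m d a
    = trans (sym (replicate-+-++ d a _))
        (push-unitise≡recordPath m (d + a) (iterate suc (suc (m + d)) a ++ w) b α
          (subst (λ k → All (_≤ k) (iterate suc (suc (m + d)) a ++ w)) (ℕ.+-assoc m d a)
            (All.++⁺ (iterate-suc-≤ (m + d) a) (All.map (λ x≤ → ℕ.≤-trans x≤ (ℕ.m≤m+n _ a)) w≤)))
          (subst (λ k → Balanced k (σ[ b ] ∷ α)) (sym |top++w|) bal)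
          (Linked.tail red))
    where
    |top++w| : length (iterate suc (suc (m + d)) a ++ w) ≡ a + length w
    |top++w| = trans (length-++ (iterate suc _ a)) (cong (_+ length w) (length-iterate suc _ a))
  -- Reducedness makes the peak `σ τ`, so the emitted element is the one just pushed, `suc (m + d)`.
  -- It exceeds all of `w` and is the next value of `m`.
  push-unitise≡recordPath m d w a (τ[ b ] ∷ α) w≤ bal (peak ∷ red) with peak push pop
  push-unitise≡recordPath m d w _ (τ[ _ ] ∷ α) w≤ (push _ (pop _ bal)) (_ ∷ red) | refl , refl =
    trans (cong (λ β → replicate d σ ++ σ ∷ τ ∷ β)
            (unitise≡recordPath (suc (m + d)) w α (All.map ℕ.m≤n⇒m≤1+n w≤) bal (Linked.tail red)))
          (sym (recordPath-above m d (emitted (iterate suc (suc (suc (m + d))) (pushSize α)) w α)))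

-- The right-hand side depends on the permutation alone, so equivalent reduced words have the same
-- unit word.
unitise-produced : ∀ {α} → WellFormed α → Reduced α →
                   unitise α ≡ recordPath 0 (reverse (produced α))
unitise-produced {α} wf red = begin
  unitise α
    ≡⟨ unitise≡recordPath 0 [] α [] (wellFormed⇒Balanced wf) red ⟩
  recordPath 0 (emitted (iterate suc 1 (size α)) [] α)
    ≡⟨ cong (λ i → recordPath 0 (emitted i [] α))
         (trans (map-upTo suc (size α)) (applyUpTo-iterate-suc suc 1 (size α) (λ _ → refl))) ⟨
  recordPath 0 (emitted (map suc (upTo (size α))) [] α)
    ≡⟨ cong (recordPath 0) (reverse-output _ [] [] α) ⟨
  recordPath 0 (reverse (produced α)) ∎
  where open ≡-Reasoning

-- Subdividing segments

shift : Point → Point → ℚ → Point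
shift (p , q) (x , y) s = (x ℚ.+ s ℚ.* p , y ℚ.+ s ℚ.* q)

shift-+ : ∀ d v r s → shift d (shift d v r) s ≡ shift d v (r ℚ.+ s)
shift-+ (p , q) (x , y) r s = cong₂ _,_ (eq x p) (eq y q)
  where
  open +-*-Solver
  eq : ∀ x p → x ℚ.+ r ℚ.* p ℚ.+ s ℚ.* p ≡ x ℚ.+ (r ℚ.+ s) ℚ.* p
  eq x p = solve 4 (λ x p r s → x :+ r :* p :+ s :* p := x :+ (r :+ s) :* p) refl x p r s

-- A bounded piece of a line, parametrised by a fixed direction `d` instead of by its endpoints, so
-- that joining collinear pieces adds their lengths.
Ray : Point → Point → ℚ → Point → Set
Ray d v r u = ∃[ s ] 0ℚ ℚ.≤ s × s ℚ.≤ r × u ≡ shift d v s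

interpolate-shift : ∀ x p r t → x ℚ.+ t ℚ.* (x ℚ.+ r ℚ.* p ℚ.- x) ≡ x ℚ.+ (t ℚ.* r) ℚ.* p
interpolate-shift = solve 4 (λ x p r t → x :+ t :* (x :+ r :* p :- x) := x :+ (t :* r) :* p) refl
  where open +-*-Solver

-- The parameter `t` in the unit interval corresponds to `t * r`; positivity of `r` makes the
-- rescaling invertible and monotone in both directions.
Segment≐Ray : ∀ d v r .{{_ : ℚ.Positive r}} → Segment v (shift d v r) ≐ Ray d v r
Segment≐Ray (p , q) (x , y) r = to , from
  where
  instance
    r≢0 : ℚ.NonZero r
    r≢0 = ℚ.pos⇒nonZero r
    r≥0 : ℚ.NonNegative r
    r≥0 = ℚ.pos⇒nonNeg r
    1/r>0 : ℚ.Positive (ℚ.1/ r)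
    1/r>0 = ℚ.1/pos⇒pos r
    1/r≥0 : ℚ.NonNegative (ℚ.1/ r)
    1/r≥0 = ℚ.pos⇒nonNeg (ℚ.1/ r)

  to : ∀ {u} → Segment (x , y) (shift (p , q) (x , y) r) u → Ray (p , q) (x , y) r u
  to (t , 0≤t , t≤1 , refl , refl) =
    t ℚ.* r ,
    subst (ℚ._≤ t ℚ.* r) (ℚ.*-zeroˡ r) (ℚ.*-monoʳ-≤-nonNeg r 0≤t) ,
    subst (t ℚ.* r ℚ.≤_) (ℚ.*-identityˡ r) (ℚ.*-monoʳ-≤-nonNeg r t≤1) ,
    cong₂ _,_ (interpolate-shift x p r t) (interpolate-shift y q r t)

  from : ∀ {u} → Ray (p , q) (x , y) r u → Segment (x , y) (shift (p , q) (x , y) r) u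
  from (s , 0≤s , s≤r , refl) =
    t ,
    subst (ℚ._≤ t) (ℚ.*-zeroˡ (ℚ.1/ r)) (ℚ.*-monoʳ-≤-nonNeg (ℚ.1/ r) 0≤s) ,
    subst (t ℚ.≤_) (ℚ.*-inverseʳ r) (ℚ.*-monoʳ-≤-nonNeg (ℚ.1/ r) s≤r) ,
    eq x p , eq y q
    where
    t = s ℚ.* ℚ.1/ r
    tr≡s : t ℚ.* r ≡ s
    tr≡s = trans (ℚ.*-assoc s _ r) (trans (cong (s ℚ.*_) (ℚ.*-inverseˡ r)) (ℚ.*-identityʳ s))
    eq : ∀ x p → x ℚ.+ s ℚ.* p ≡ x ℚ.+ t ℚ.* (x ℚ.+ r ℚ.* p ℚ.- x)
    eq x p = sym (trans (interpolate-shift x p r t) (cong (λ k → x ℚ.+ k ℚ.* p) tr≡s))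

Ray-split : ∀ d v r s .{{_ : ℚ.NonNegative r}} .{{_ : ℚ.NonNegative s}} →
            Ray d v (r ℚ.+ s) ≐ Ray d v r ∪ Ray d (shift d v r) s
Ray-split d v r s = to , from
  where
  r+[t-r]≡t : ∀ t → r ℚ.+ (t ℚ.- r) ≡ t
  r+[t-r]≡t = solve 2 (λ r t → r :+ (t :- r) := t) refl r
    where open +-*-Solver

  -- A parameter beyond `r` is measured afresh from the cut point by subtracting `r`.
  to : ∀ {u} → Ray d v (r ℚ.+ s) u → (Ray d v r ∪ Ray d (shift d v r) s) u
  to (t , 0≤t , t≤r+s , refl) with ℚ.≤-total t r
  ... | inj₁ t≤r = inj₁ (t , 0≤t , t≤r , refl)
  ... | inj₂ r≤t = inj₂
    (t ℚ.- r ,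
     subst (ℚ._≤ t ℚ.- r) (ℚ.+-inverseʳ r) (ℚ.+-monoˡ-≤ (ℚ.- r) r≤t) ,
     subst (t ℚ.- r ℚ.≤_) [r+s]-r≡s (ℚ.+-monoˡ-≤ (ℚ.- r) t≤r+s) ,
     sym (trans (shift-+ d v r (t ℚ.- r)) (cong (shift d v) (r+[t-r]≡t t))))
    where
    open +-*-Solver
    [r+s]-r≡s : r ℚ.+ s ℚ.- r ≡ s
    [r+s]-r≡s = solve 2 (λ r s → r :+ s :- r := s) refl r s

  from : ∀ {u} → (Ray d v r ∪ Ray d (shift d v r) s) u → Ray d v (r ℚ.+ s) u
  from (inj₁ (t , 0≤t , t≤r , refl)) =
    t , 0≤t ,
    subst (ℚ._≤ r ℚ.+ s) (ℚ.+-identityʳ t) (ℚ.+-mono-≤ t≤r (ℚ.nonNegative⁻¹ s)) ,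
    refl
  from (inj₂ (t , 0≤t , t≤s , refl)) =
    r ℚ.+ t ,
    ℚ.+-mono-≤ (ℚ.nonNegative⁻¹ r) 0≤t ,
    ℚ.+-monoʳ-≤ r t≤s ,
    shift-+ d v r t

Segment-split : ∀ d v r s .{{_ : ℚ.Positive r}} .{{_ : ℚ.Positive s}} →
                Segment v (shift d v (r ℚ.+ s)) ≐
                Segment v (shift d v r) ∪ Segment (shift d v r) (shift d (shift d v r) s)
Segment-split d v r s =
  ≐-trans (Segment≐Ray d v (r ℚ.+ s))
    (≐-trans (Ray-split d v r s)
      (≐-sym (∪-cong (Segment≐Ray d v r) (Segment≐Ray d (shift d v r) s))))
  where
  instance
    r≥0 : ℚ.NonNegative r
    r≥0 = ℚ.pos⇒nonNeg r
    s≥0 : ℚ.NonNegative s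
    s≥0 = ℚ.pos⇒nonNeg s
    r+s>0 : ℚ.Positive (r ℚ.+ s)
    r+s>0 = ℚ.nonNeg+pos⇒pos r s

-- Unitising preserves the profile

-- The profile with a free starting point, as induction on the word requires.
path : Point → Word → Point → Set
path v α = PolygonalPath (scanl move v α)

path-cong-∷ : ∀ x α β → (∀ v → path v α ≐ path v β) → ∀ v → path v (x ∷ α) ≐ path v (x ∷ β)
path-cong-∷ x α β α≐β v = ∪-cong ≐-refl (α≐β (move v x))

suc/1 : ∀ n → + suc n ℚ./ 1 ≡ 1ℚ ℚ.+ + n ℚ./ 1
suc/1 n = sym (begin
  -- Once `n / 1` is an explicit fraction in lowest terms, rational addition computes.
  1ℚ ℚ.+ + n ℚ./ 1          ≡⟨ cong (1ℚ ℚ.+_) (ℚ.normalize-coprime n⊥1) ⟩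
  1ℚ ℚ.+ ℚ.mkℚ (+ n) 0 n⊥1  ≡⟨ cong (ℚ._/ 1) (cong (λ i → + 1 ℤ.+ i) (ℤ.*-identityʳ (+ n))) ⟩
  + suc n ℚ./ 1             ∎)
  where
  open ≡-Reasoning
  n⊥1 = Coprimality.sym (1-coprimeTo n)

move-σ : ∀ v a .{{_ : NonZero a}} → move v σ[ a ] ≡ shift (1ℚ , 1ℚ) v (+ a ℚ./ 1)
move-σ (x , y) a = cong₂ _,_ (cong (x ℚ.+_) (sym (ℚ.*-identityʳ _))) (cong (y ℚ.+_) (sym (ℚ.*-identityʳ _)))

move-τ : ∀ v b .{{_ : NonZero b}} → move v τ[ b ] ≡ shift (1ℚ , ℚ.- 1ℚ) v (+ b ℚ./ 1)
move-τ (x , y) b = cong₂ _,_ (cong (x ℚ.+_) (sym (ℚ.*-identityʳ _))) (cong (y ℚ.+_) (eq (+ b ℚ./ 1)))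
  where
  open +-*-Solver
  eq : ∀ r → ℚ.- r ≡ r ℚ.* ℚ.- 1ℚ
  eq = solve 1 (λ r → :- r := r :* (:- con 1ℚ)) refl

-- Pushes and pops are treated together: the direction `d` is `(1ℚ , 1ℚ)` for pushes and
-- `(1ℚ , ℚ.- 1ℚ)` for pops.
module _ (d : Point) (op : ∀ n .{{_ : NonZero n}} → Op)
         (move-op : ∀ v n .{{_ : NonZero n}} → move v (op n) ≡ shift d v (+ n ℚ./ 1)) where

  move-suc : ∀ v n .{{_ : NonZero n}} → move v (op (suc n)) ≡ move (move v (op 1)) (op n)
  move-suc v n
    rewrite move-op v (suc n) {{_}} | move-op v 1 {{_}} | move-op (shift d v 1ℚ) n {{it}} | suc/1 n
    = sym (shift-+ d v 1ℚ (+ n ℚ./ 1))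

  -- The unit piece cut off has the same direction as the remainder, so the extra vertex lies on the
  -- old segment.
  path-suc : ∀ v n .{{_ : NonZero n}} α → path v (op (suc n) ∷ α) ≐ path v (op 1 ∷ op n ∷ α)
  path-suc v n α rewrite move-suc v n {{it}} =
    ≐-trans (∪-cong segment ≐-refl) (∪-assoc _ _ _)
    where
    segment : Segment v (move (move v (op 1)) (op n)) ≐
              Segment v (move v (op 1)) ∪ Segment (move v (op 1)) (move (move v (op 1)) (op n))
    segment rewrite move-op v 1 {{_}} | move-op (shift d v 1ℚ) n {{it}} =
      subst (λ w → Segment v w ≐ Segment v (shift d v 1ℚ) ∪ Segment (shift d v 1ℚ) (shift d (shift d v 1ℚ) (+ n ℚ./ 1)))
        (sym (shift-+ d v 1ℚ (+ n ℚ./ 1)))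
        (Segment-split d v 1ℚ (+ n ℚ./ 1) {{_}} {{ℚ.normalize-pos n 1}})

  path-replicate : ∀ n .{{_ : NonZero n}} α v → path v (op n ∷ α) ≐ path v (replicate n (op 1) ++ α)
  path-replicate (suc zero)    α v = ≐-refl
  path-replicate (suc (suc n)) α v =
    ≐-trans (path-suc v (suc n) α) (path-cong-∷ (op 1) (op (suc n) ∷ α) (replicate (suc n) (op 1) ++ α) (path-replicate (suc n) α) v)

path-unitise : ∀ α v → path v α ≐ path v (unitise α)
path-unitise []           v = ≐-refl
path-unitise (σ[ a ] ∷ α) v =
  ≐-trans (path-cong-∷ σ[ a ] α (unitise α) (path-unitise α) v)
          (path-replicate (1ℚ , 1ℚ) (λ n → σ[ n ]) move-σ a (unitise α) v)
path-unitise (τ[ b ] ∷ α) v =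
  ≐-trans (path-cong-∷ τ[ b ] α (unitise α) (path-unitise α) v)
          (path-replicate (1ℚ , ℚ.- 1ℚ) (λ n → τ[ n ]) move-τ b (unitise α) v)

mainTheorem9 : (α β : Word) → WellFormed α → WellFormed β → Reduced α → Reduced β → Equivalent α β → profile α ≐ profile β
mainTheorem9 α β wfα wfβ redα redβ (_ , same-output) =
  -- Both profiles are compared with the path of the common unit word.
  ≐-trans (path-unitise α _)
    (subst (λ γ → path _ γ ≐ profile β) (sym same-unitise) (≐-sym (path-unitise β _)))
  where
  same-unitise : unitise α ≡ unitise β
  same-unitise = trans (unitise-produced wfα redα)
    (trans (cong (recordPath 0 ∘ reverse) same-output) (sym (unitise-produced wfβ redβ)))
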